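{- Let $e$ be the base of the natural logarithm. For every $a\in\mathbb{Z}\setminus\{0,1\}$, the functions $\mathbb{N}\to\mathbb{Z}$ $$\phi_a^-: x\mapsto\lfloor e^{1/a}\,a^x\,x!\rfloor,\qquad \phi_a^+: x\mapsto\lceil e^{1/a}\,a^x\,x!\rceil$$ have integral difference ratios. Moreover, the following two functions $\mathbb{N}\to\mathbb{Z}$ also have integral difference ratios: $$\phi_1^-(x)=\begin{cases}1&\text{if }x=0\\ \lfloor e\,x!\rfloor&\text{if }x\geq 1\end{cases}\qquad\qquad \phi_1^+(x)=\begin{cases}2&\text{if }x=0\\ \lceil e\,x!\rceil&\text{if }x\geq 1.\end{cases}$$
   Context: $\mathbb{N}$ denotes the non-negative integers. A function $f:\mathbb{N}\to\mathbb{Z}$ has integral difference ratios if $a-b$ divides $f(a)-f(b)$ for all $a,b\in\mathbb{N}$ with $a\neq b$. -}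

module Defs where

open import Data.Nat.Base as ℕ using (ℕ; zero; suc; _!)
import Data.Nat.Properties as ℕ
open import Data.Integer.Base as ℤ using (ℤ; +_; 1ℤ)
import Data.Integer.Properties as ℤ
open import Data.Integer.Divisibility.Signed using () renaming (_∣_ to _∣ℤ_)
open import Data.Rational.Base
  using (ℚ; mkℚ; 0ℚ; 1ℚ; _/_; 1/_; _+_; _*_; _-_; -_; ∣_∣; _<_; _≤_; ↥_; *≤*; *<*; toℚᵘ;
         positive; nonNegative; +-*-rawSemiring)
open import Data.Rational.Properties
open import Data.Rational.Literals using (fromℤ)
open import Data.Rational.Solver using (module +-*-Solver)
import Data.Rational.Unnormalised.Base as ℚᵘ
import Data.Rational.Unnormalised.Properties as ℚᵘ
open import Algebra.Definitions.RawSemiring +-*-rawSemiring using (_^_)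
open import Data.Product.Base using (_×_; _,_; ∃-syntax)
open import Data.Sum.Base using (inj₁; inj₂)
open import Relation.Nullary.Negation.Core using (¬_)
open import Relation.Binary.PropositionalEquality hiding (J)

IntegralDifferenceRatios : (ℕ → ℤ) → Set
IntegralDifferenceRatios f = ∀ a b → a ≢ b → (+ a ℤ.- + b) ∣ℤ (f a ℤ.- f b)

-- ℝ is not quotiented: different Cauchy sequences may represent the same real,
-- and the order relations depend only on the limits.

IsCauchy : (ℕ → ℚ) → Set
IsCauchy s = ∀ ε → 0ℚ < ε → ∃[ N ] (∀ m n → N ℕ.≤ m → N ℕ.≤ n → ∣ s m - s n ∣ < ε)

record ℝ : Set where
  constructor mkℝ
  field
    seq    : ℕ → ℚ
    cauchy : IsCauchy seq
open ℝ public

infix 4 _<ᴿ_ _≤ᴿ_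

_<ᴿ_ : ℝ → ℝ → Set
r <ᴿ s = ∃[ ε ] 0ℚ < ε × ∃[ N ] (∀ n → N ℕ.≤ n → seq r n + ε ≤ seq s n)

_≤ᴿ_ : ℝ → ℝ → Set
r ≤ᴿ s = ¬ (s <ᴿ r)

fromℚ : ℚ → ℝ
fromℚ p = mkℝ (λ _ → p) λ ε 0<ε → 0 , λ _ _ _ _ →
  subst (_< ε) (sym (cong ∣_∣ (+-inverseʳ p))) 0<ε

ℤ→ℝ : ℤ → ℝ
ℤ→ℝ n = fromℚ (fromℤ n)

-- Floor and ceiling are relations, since they cannot be computed from an
-- arbitrary Cauchy sequence.

infix 4 _IsFloorOf_ _IsCeilingOf_

_IsFloorOf_ : ℤ → ℝ → Set
n IsFloorOf r = ℤ→ℝ n ≤ᴿ r × r <ᴿ ℤ→ℝ (n ℤ.+ 1ℤ)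

_IsCeilingOf_ : ℤ → ℝ → Set
n IsCeilingOf r = ℤ→ℝ (n ℤ.- 1ℤ) <ᴿ r × r ≤ᴿ ℤ→ℝ n

fromℤ-mono-≤ : ∀ {i j} → i ℤ.≤ j → fromℤ i ≤ fromℤ j
fromℤ-mono-≤ i≤j = *≤* (ℤ.*-monoʳ-≤-nonNeg 1ℤ i≤j)

floor-unique : ∀ {m n r} → m IsFloorOf r → n IsFloorOf r → m ≡ n
floor-unique {r = r} (m≤r , r<m+1) (n≤r , r<n+1) = ℤ.≤-antisym (lower m≤r r<n+1) (lower n≤r r<m+1)
  where
  lower : ∀ {i j} → ℤ→ℝ i ≤ᴿ r → r <ᴿ ℤ→ℝ (j ℤ.+ 1ℤ) → i ℤ.≤ j
  lower {i} {j} i≤r (ε , 0<ε , N , le) = ℤ.≮⇒≥ λ j<i → i≤r (ε , 0<ε , N , λ k N≤k →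
    ≤-trans (le k N≤k) (fromℤ-mono-≤ (subst (ℤ._≤ i) (ℤ.+-comm 1ℤ j) (ℤ.i<j⇒suc[i]≤j j<i))))

ceiling-unique : ∀ {m n r} → m IsCeilingOf r → n IsCeilingOf r → m ≡ n
ceiling-unique {r = r} (m-1<r , r≤m) (n-1<r , r≤n) = ℤ.≤-antisym (upper m-1<r r≤n) (upper n-1<r r≤m)
  where
  upper : ∀ {i j} → ℤ→ℝ (i ℤ.- 1ℤ) <ᴿ r → r ≤ᴿ ℤ→ℝ j → i ℤ.≤ j
  upper {i} {j} (ε , 0<ε , N , le) r≤j = ℤ.≮⇒≥ λ j<i → r≤j (ε , 0<ε , N , λ k N≤k →
    ≤-trans (+-monoˡ-≤ ε (fromℤ-mono-≤ (subst (j ℤ.≤_) (ℤ.+-comm ℤ.-1ℤ i) (ℤ.i<j⇒i≤pred[j] j<i)))) (le k N≤k))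

0<⇒*-inv : ∀ p (0<p : 0ℚ < p) q → let instance _ = pos⇒nonZero p {{positive 0<p}} in
           p * (q * 1/ p) ≡ q
0<⇒*-inv p 0<p q = trans (cong (p *_) (*-comm q (1/ p)))
  (trans (sym (*-assoc p (1/ p) q)) (trans (cong (_* q) (*-inverseʳ p)) (*-identityˡ q)))
  where instance _ = pos⇒nonZero p {{positive 0<p}}

0<* : ∀ {p q} → 0ℚ < p → 0ℚ < q → 0ℚ < p * q
0<* {p} {q} 0<p 0<q = positive⁻¹ (p * q) {{pos*pos⇒pos p {{positive 0<p}} q {{positive 0<q}}}}

0<1ℚ : 0ℚ < 1ℚ
0<1ℚ = *<* (ℤ.+<+ (ℕ.s≤s ℕ.z≤n))

p<p+1 : ∀ p → p < p + 1ℚ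
p<p+1 p = subst (_< p + 1ℚ) (+-identityʳ p) (+-monoʳ-< p 0<1ℚ)

*-monoˡ : ∀ {r p q} → 0ℚ ≤ r → p ≤ q → r * p ≤ r * q
*-monoˡ {r} 0≤r = *-monoˡ-≤-nonNeg r {{nonNegative 0≤r}}

*-monoʳ : ∀ {r p q} → 0ℚ ≤ r → p ≤ q → p * r ≤ q * r
*-monoʳ {r} 0≤r = *-monoʳ-≤-nonNeg r {{nonNegative 0≤r}}

scale-cauchy : ∀ p (s : ℕ → ℚ) → IsCauchy s → IsCauchy (λ n → p * s n)
scale-cauchy p s cs ε 0<ε = let (N , close) = cs δ 0<δ in N , λ m n N≤m N≤n → begin-strict
  ∣ p * s m - p * s n ∣    ≡⟨ cong ∣_∣ (solve 3 (λ p x y → p :* x :- p :* y := p :* (x :- y)) refl p (s m) (s n)) ⟩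
  ∣ p * (s m - s n) ∣      ≡⟨ ∣p*q∣≡∣p∣*∣q∣ p (s m - s n) ⟩
  ∣ p ∣ * ∣ s m - s n ∣    ≤⟨ *-monoʳ (0≤∣p∣ (s m - s n)) (<⇒≤ (p<p+1 ∣ p ∣)) ⟩
  M * ∣ s m - s n ∣        <⟨ *-monoʳ-<-pos M {{positive 0<M}} (close m n N≤m N≤n) ⟩
  M * δ                    ≡⟨ 0<⇒*-inv M 0<M ε ⟩
  ε                        ∎
  where
  open ≤-Reasoning
  open +-*-Solver
  M : ℚ
  M = ∣ p ∣ + 1ℚ
  0<M : 0ℚ < M
  0<M = ≤-<-trans (0≤∣p∣ p) (p<p+1 ∣ p ∣)
  instance _ = pos⇒nonZero M {{positive 0<M}}
  δ : ℚ
  δ = ε * 1/ M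
  0<δ : 0ℚ < δ
  0<δ = 0<* 0<ε (positive⁻¹ (1/ M) {{1/pos⇒pos M {{positive 0<M}}}})

infixr 7 _·_

_·_ : ℚ → ℝ → ℝ
p · r = mkℝ (λ n → p * seq r n) (scale-cauchy p (seq r) (cauchy r))

expTerm : ℚ → ℕ → ℚ
expTerm q k = q ^ k * (1ℤ / (k !)) {{k ℕ.!≢0}}

-- expSum q n is the sum of q ^ k / k ! over k < n.
expSum : ℚ → ℕ → ℚ
expSum q zero    = 0ℚ
expSum q (suc n) = expSum q n + expTerm q n

fromℕ : ℕ → ℚ
fromℕ n = fromℤ (+ n)

fromℕ-suc : ∀ n → fromℕ (suc n) ≡ fromℕ n + 1ℚ
fromℕ-suc n = toℚᵘ-injective (ℚᵘ.≃-trans (ℚᵘ.*≡* lem) (ℚᵘ.≃-sym (toℚᵘ-homo-+ (fromℕ n) 1ℚ)))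
  where
  lem : + suc n ℤ.* 1ℤ ≡ (+ n ℤ.* 1ℤ ℤ.+ 1ℤ) ℤ.* 1ℤ
  lem = cong (ℤ._* 1ℤ) (trans (cong +_ (ℕ.+-comm 1 n)) (cong (ℤ._+ 1ℤ) (sym (ℤ.*-identityʳ (+ n)))))

fromℕ-* : ∀ m n → fromℕ (m ℕ.* n) ≡ fromℕ m * fromℕ n
fromℕ-* m n = toℚᵘ-injective (ℚᵘ.≃-trans (ℚᵘ.*≡* (cong (ℤ._* 1ℤ) (ℤ.pos-* m n)))
  (ℚᵘ.≃-sym (toℚᵘ-homo-* (fromℕ m) (fromℕ n))))

fromℕ-mono-≤ : ∀ {m n} → m ℕ.≤ n → fromℕ m ≤ fromℕ n
fromℕ-mono-≤ m≤n = fromℤ-mono-≤ (ℤ.+≤+ m≤n)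

0≤fromℕ : ∀ n → 0ℚ ≤ fromℕ n
0≤fromℕ n = fromℕ-mono-≤ {0} {n} ℕ.z≤n

0<fromℕ : ∀ n → 0ℚ < fromℕ (suc n)
0<fromℕ n = positive⁻¹ (fromℕ (suc n))

fromℕ*1/ : ∀ n .{{_ : ℕ.NonZero n}} → fromℕ n * (1ℤ / n) ≡ 1ℚ
fromℕ*1/ n@(suc n-1) = toℚᵘ-injective (ℚᵘ.≃-trans (toℚᵘ-homo-* (fromℕ n) (1ℤ / n))
  (ℚᵘ.≃-trans (ℚᵘ.*-cong (ℚᵘ.≃-refl {toℚᵘ (fromℕ n)}) (toℚᵘ-fromℚᵘ (ℚᵘ.mkℚᵘ 1ℤ n-1)))
    (ℚᵘ.*≡* (cong +_ lem))))
  where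
  lem : n ℕ.* 1 ℕ.* 1 ≡ 1 ℕ.* (1 ℕ.* n)
  lem = trans (ℕ.*-identityʳ (n ℕ.* 1)) (trans (ℕ.*-identityʳ n)
          (sym (trans (ℕ.*-identityˡ (1 ℕ.* n)) (ℕ.*-identityˡ n))))

p≤∣↥p∣ : ∀ p → p ≤ fromℕ (ℤ.∣ ↥ p ∣)
p≤∣↥p∣ (mkℚ (+ n) d _) = *≤* (subst₂ ℤ._≤_ (ℤ.pos-* n 1) (ℤ.pos-* n (suc d))
  (ℤ.+≤+ (ℕ.*-monoʳ-≤ n (ℕ.s≤s {0} {d} ℕ.z≤n))))
p≤∣↥p∣ (mkℚ ℤ.-[1+ n ] d _) = *≤* ℤ.-≤+

expTerm-suc : ∀ q k → fromℕ (suc k) * expTerm q (suc k) ≡ q * expTerm q k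
expTerm-suc q k = begin
  s * (q * x * u)                ≡⟨ *-identityʳ _ ⟨
  s * (q * x * u) * 1ℚ           ≡⟨ cong (s * (q * x * u) *_) (fromℕ*1/ (k !)) ⟨
  s * (q * x * u) * (f * v)      ≡⟨ solve 6 (λ s q x u f v → s :* (q :* x :* u) :* (f :* v) := s :* f :* u :* (q :* (x :* v))) refl s q x u f v ⟩
  s * f * u * (q * (x * v))      ≡⟨ cong (λ z → z * u * (q * (x * v))) (fromℕ-* (suc k) (k !)) ⟨
  fromℕ (suc k !) * u * (q * (x * v)) ≡⟨ cong (_* (q * (x * v))) (fromℕ*1/ (suc k !)) ⟩
  1ℚ * (q * (x * v))             ≡⟨ *-identityˡ _ ⟩
  q * (x * v)                    ∎
  where
  open ≡-Reasoning
  open +-*-Solver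
  instance
    _ = k ℕ.!≢0
    _ = suc k ℕ.!≢0
  s x u f v : ℚ
  s = fromℕ (suc k)
  x = q ^ k
  u = 1ℤ / (suc k !)
  f = fromℕ (k !)
  v = 1ℤ / (k !)

module ExpCauchy (q : ℚ) where
  open ≤-Reasoning
  open +-*-Solver

  t : ℕ → ℚ
  t k = ∣ expTerm q k ∣

  0≤t : ∀ k → 0ℚ ≤ t k
  0≤t k = 0≤∣p∣ (expTerm q k)

  two : ℚ
  two = fromℕ 2

  B : ℕ
  B = ℤ.∣ ↥ ∣ q ∣ ∣

  K : ℕ
  K = 2 ℕ.* B

  t-suc : ∀ k → fromℕ (suc k) * t (suc k) ≡ ∣ q ∣ * t k
  t-suc k = trans (sym (∣p*q∣≡∣p∣*∣q∣ (fromℕ (suc k)) (expTerm q (suc k))))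
    (trans (cong ∣_∣ (expTerm-suc q k)) (∣p*q∣≡∣p∣*∣q∣ q (expTerm q k)))

  halving : ∀ k → K ℕ.≤ k → two * t (suc k) ≤ t k
  halving k K≤k = *-cancelˡ-≤-pos (fromℕ (suc k)) (begin
    fromℕ (suc k) * (two * t (suc k))  ≡⟨ solve 3 (λ a b c → a :* (b :* c) := b :* (a :* c)) refl (fromℕ (suc k)) two (t (suc k)) ⟩
    two * (fromℕ (suc k) * t (suc k))  ≡⟨ cong (two *_) (t-suc k) ⟩
    two * (∣ q ∣ * t k)                ≤⟨ *-monoˡ (0≤fromℕ 2) (*-monoʳ (0≤t k) (p≤∣↥p∣ ∣ q ∣)) ⟩
    two * (fromℕ B * t k)              ≡⟨ *-assoc two (fromℕ B) (t k) ⟨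
    two * fromℕ B * t k                ≡⟨ cong (_* t k) (fromℕ-* 2 B) ⟨
    fromℕ K * t k                      ≤⟨ *-monoʳ (0≤t k) (fromℕ-mono-≤ (ℕ.m≤n⇒m≤1+n K≤k)) ⟩
    fromℕ (suc k) * t k                ∎)

  t-decay : ∀ j → fromℕ (suc j) * t (j ℕ.+ K) ≤ t K
  t-decay zero    = ≤-reflexive (*-identityˡ (t K))
  t-decay (suc j) = begin
    fromℕ (suc (suc j)) * t (suc (j ℕ.+ K))      ≤⟨ *-monoʳ (0≤t (suc (j ℕ.+ K))) (fromℕ-mono-≤ 2+j≤2*[1+j]) ⟩
    fromℕ (2 ℕ.* suc j) * t (suc (j ℕ.+ K))      ≡⟨ cong (_* t (suc (j ℕ.+ K))) (fromℕ-* 2 (suc j)) ⟩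
    two * fromℕ (suc j) * t (suc (j ℕ.+ K))      ≡⟨ solve 3 (λ a b c → a :* b :* c := b :* (a :* c)) refl two (fromℕ (suc j)) (t (suc (j ℕ.+ K))) ⟩
    fromℕ (suc j) * (two * t (suc (j ℕ.+ K)))    ≤⟨ *-monoˡ (0≤fromℕ (suc j)) (halving (j ℕ.+ K) (ℕ.m≤n+m K j)) ⟩
    fromℕ (suc j) * t (j ℕ.+ K)                  ≤⟨ t-decay j ⟩
    t K                                          ∎
    where
    2+j≤2*[1+j] : suc (suc j) ℕ.≤ 2 ℕ.* suc j
    2+j≤2*[1+j] = ℕ.s≤s (subst (suc j ℕ.≤_) (cong (j ℕ.+_) (sym (ℕ.+-identityʳ (suc j)))) (ℕ.m≤n+m (suc j) j))

  two* : ∀ p → two * p ≡ p + p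
  two* p = solve 1 (λ x → con two :* x := x :+ x) refl p

  tail : ∀ n → K ℕ.≤ n → ∀ j → ∣ expSum q (j ℕ.+ n) - expSum q n ∣ + two * t (j ℕ.+ n) ≤ two * t n
  tail n K≤n zero    = ≤-reflexive (trans (cong (λ z → ∣ z ∣ + two * t n) (+-inverseʳ (expSum q n))) (+-identityˡ _))
  tail n K≤n (suc j) = begin
    ∣ S + e - s ∣ + two * t (suc (j ℕ.+ n))      ≡⟨ cong (λ z → ∣ z ∣ + two * t (suc (j ℕ.+ n))) (solve 3 (λ S e s → S :+ e :- s := (S :- s) :+ e) refl S e s) ⟩
    ∣ (S - s) + e ∣ + two * t (suc (j ℕ.+ n))    ≤⟨ +-mono-≤ (∣p+q∣≤∣p∣+∣q∣ (S - s) e) (halving (j ℕ.+ n) (ℕ.≤-trans K≤n (ℕ.m≤n+m n j))) ⟩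
    ∣ S - s ∣ + ∣ e ∣ + ∣ e ∣                    ≡⟨ +-assoc (∣ S - s ∣) (∣ e ∣) (∣ e ∣) ⟩
    ∣ S - s ∣ + (∣ e ∣ + ∣ e ∣)                  ≡⟨ cong (λ z → ∣ S - s ∣ + z) (two* (∣ e ∣)) ⟨
    ∣ S - s ∣ + two * t (j ℕ.+ n)                ≤⟨ tail n K≤n j ⟩
    two * t n                                    ∎
    where
    S e s : ℚ
    S = expSum q (j ℕ.+ n)
    e = expTerm q (j ℕ.+ n)
    s = expSum q n

  tail′ : ∀ m n → K ℕ.≤ n → n ℕ.≤ m → ∣ expSum q m - expSum q n ∣ ≤ two * t n
  tail′ m n K≤n n≤m = subst (λ k → ∣ expSum q k - expSum q n ∣ ≤ two * t n) (ℕ.m∸n+n≡m n≤m) (begin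
    D                       ≡⟨ +-identityʳ D ⟨
    D + 0ℚ                  ≤⟨ +-monoʳ-≤ D (*-monoˡ (0≤fromℕ 2) (0≤t (j ℕ.+ n))) ⟩
    D + two * t (j ℕ.+ n)   ≤⟨ tail n K≤n j ⟩
    two * t n               ∎)
    where
    j : ℕ
    j = m ℕ.∸ n
    D : ℚ
    D = ∣ expSum q (j ℕ.+ n) - expSum q n ∣

  expSum-cauchy : IsCauchy (expSum q)
  expSum-cauchy ε 0<ε = J ℕ.+ K , close
    where
    instance _ = pos⇒nonZero ε {{positive 0<ε}}
    c : ℚ
    c = two * t K * 1/ ε
    J : ℕ
    J = ℤ.∣ ↥ c ∣

    small : ∀ n → J ℕ.+ K ℕ.≤ n → two * t n < ε
    small n J+K≤n = *-cancelˡ-<-nonNeg (fromℕ (suc j)) (begin-strict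
      fromℕ (suc j) * (two * t n)          ≡⟨ solve 3 (λ a b c → a :* (b :* c) := b :* (a :* c)) refl (fromℕ (suc j)) two (t n) ⟩
      two * (fromℕ (suc j) * t n)          ≡⟨ cong (λ k → two * (fromℕ (suc j) * t k)) (ℕ.m∸n+n≡m K≤n) ⟨
      two * (fromℕ (suc j) * t (j ℕ.+ K))  ≤⟨ *-monoˡ (0≤fromℕ 2) (t-decay j) ⟩
      two * t K                            ≡⟨ 0<⇒*-inv ε 0<ε (two * t K) ⟨
      ε * c                                ≤⟨ *-monoˡ (<⇒≤ 0<ε) (≤-trans (p≤∣↥p∣ c) (fromℕ-mono-≤ J≤j)) ⟩
      ε * fromℕ j                          <⟨ *-monoʳ-<-pos ε {{positive 0<ε}} (subst (fromℕ j <_) (sym (fromℕ-suc j)) (p<p+1 (fromℕ j))) ⟩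
      ε * fromℕ (suc j)                    ≡⟨ *-comm ε (fromℕ (suc j)) ⟩
      fromℕ (suc j) * ε                    ∎)
      where
      K≤n : K ℕ.≤ n
      K≤n = ℕ.≤-trans (ℕ.m≤n+m K J) J+K≤n
      j : ℕ
      j = n ℕ.∸ K
      J≤j : J ℕ.≤ j
      J≤j = subst (ℕ._≤ j) (ℕ.m+n∸n≡m J K) (ℕ.∸-monoˡ-≤ K J+K≤n)

    ordered : ∀ m n → J ℕ.+ K ℕ.≤ n → n ℕ.≤ m → ∣ expSum q m - expSum q n ∣ < ε
    ordered m n N≤n n≤m = ≤-<-trans (tail′ m n (ℕ.≤-trans (ℕ.m≤n+m K J) N≤n) n≤m) (small n N≤n)

    flip : ∀ x y → ∣ x - y ∣ ≡ ∣ y - x ∣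
    flip x y = trans (sym (∣-p∣≡∣p∣ (x - y))) (cong ∣_∣ (solve 2 (λ x y → :- (x :- y) := y :- x) refl x y))

    close : ∀ m n → J ℕ.+ K ℕ.≤ m → J ℕ.+ K ℕ.≤ n → ∣ expSum q m - expSum q n ∣ < ε
    close m n N≤m N≤n with ℕ.≤-total n m
    ... | inj₁ n≤m = ordered m n N≤n n≤m
    ... | inj₂ m≤n = subst (_< ε) (flip (expSum q n) (expSum q m)) (ordered n m N≤m m≤n)

-- For integers a ≠ 0, e^{1/a} is exp (1/ fromℤ a).
exp : ℚ → ℝ
exp q = mkℝ (expSum q) (ExpCauchy.expSum-cauchy q)

e : ℝ
e = exp 1ℚ

{-# OPTIONS --safe #-}

-- Let P x be the sum of a ^ (x - k) * x ! / k ! over k ≤ x, and T, T′, … the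
-- terms for k = x + 1, x + 2, …. The recurrence P (x + 1) = a (x + 1) P x + 1
-- shows that P is an integer and, by induction on x, that d divides
-- P (x + d) - P x. The terms after T′ add up to at most T′ / 2 in absolute
-- value, and T′ > 0 whatever the sign of a. Hence a ^ x * x ! * e^{1/a} lies
-- between P x + T + T′ / 2 and P x + T + 3 T′ / 2, so strictly between P x and
-- P x + 1 if a > 0 (unless a = 1 and x = 0), and strictly between P x - 1 and
-- P x if a < 0. Floor and ceiling are therefore P plus a constant.

module Submission where

open import Defs
open import Data.Nat.Base using (ℕ; _≥_; _!)
open import Data.Integer.Base using (ℤ; +_; _*_; _^_; NonZero)
open import Data.Rational.Base using (1/_)
open import Data.Rational.Literals using (fromℤ)
open import Data.Product.Base using (_×_; ∃-syntax)
open import Relation.Binary.PropositionalEquality using (_≡_; _≢_)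

open import Data.Nat.Base using (zero; suc; s≤s; z≤n)
import Data.Nat.Base as ℕ
import Data.Nat.Properties as ℕ
open import Data.Integer.Base using (-[1+_]; 1ℤ; -1ℤ; 0ℤ; ∣_∣)
import Data.Integer.Base as ℤ
import Data.Integer.Properties as ℤ
import Data.Integer.Solver as ℤ
open import Data.Integer.Divisibility.Signed
  using (divides; ∣m∣n⇒∣m+n; ∣n⇒∣m*n; ∣ᵤ⇒∣; ∣⇒∣ᵤ) renaming (_∣_ to _∣ℤ_)
open import Data.Nat.Divisibility using () renaming (_∣_ to _∣ᵤ_)
open import Data.Rational.Base using (ℚ; 0ℚ; 1ℚ; ½; _+_; _-_; -_; _<_; _≤_)
import Data.Rational.Base as ℚ
import Data.Rational.Properties as ℚ
import Data.Rational.Solver as ℚ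
import Data.Rational.Unnormalised.Base as ℚᵘ
import Data.Rational.Unnormalised.Properties as ℚᵘ
open import Data.Product.Base using (_,_)
open import Data.Sum.Base using (inj₁; inj₂)
open import Relation.Binary.PropositionalEquality
  using (refl; sym; trans; cong; cong₂; subst; subst₂; module ≡-Reasoning)
open import Relation.Nullary.Negation using (contradiction)

-- The integers P x and their difference ratios

scaledSum : ℤ → ℕ → ℤ
scaledSum a zero    = 1ℤ
scaledSum a (suc x) = a * + suc x * scaledSum a x ℤ.+ 1ℤ

scaledSum-periodic : ∀ a d x → + d ∣ℤ scaledSum a (x ℕ.+ d) ℤ.- scaledSum a x
scaledSum-periodic a zero    zero = divides 0ℤ refl
-- The value 1 at 0 cancels the constant of the recurrence and leaves a multiple of `suc d`.
scaledSum-periodic a (suc d) zero = divides (a * scaledSum a d)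
  (solve 3 (λ a d s → (a :* d :* s :+ con 1ℤ) :- con 1ℤ := (a :* s) :* d) refl a (+ suc d) (scaledSum a d))
  where open ℤ.+-*-Solver
-- With y = x + 1, s = P (x + d) and t = P x, the difference is a y (s - t) + a s d: the first
-- summand falls to the induction hypothesis, the second is a multiple of d.
scaledSum-periodic a d (suc x) = subst (+ d ∣ℤ_)
  (solve 5 (λ a d y s t → a :* y :* (s :- t) :+ a :* s :* d
      := (a :* (y :+ d) :* s :+ con 1ℤ) :- (a :* y :* t :+ con 1ℤ))
    refl a (+ d) (+ suc x) (scaledSum a (x ℕ.+ d)) (scaledSum a x))
  (∣m∣n⇒∣m+n (∣n⇒∣m*n (a * + suc x) (scaledSum-periodic a d x))
    (divides (a * scaledSum a (x ℕ.+ d)) refl))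
  where open ℤ.+-*-Solver

periodic⇒integralDifferenceRatios : ∀ f → (∀ d x → + d ∣ℤ f (x ℕ.+ d) ℤ.- f x) → IntegralDifferenceRatios f
periodic⇒integralDifferenceRatios f periodic a b _ with ℕ.≤-total b a
... | inj₁ b≤a = subst₂ _∣ℤ_ (sym (trans (ℤ.m-n≡m⊖n a b) (ℤ.⊖-≥ b≤a)))
  (cong (λ k → f k ℤ.- f b) (ℕ.m+[n∸m]≡n b≤a)) (periodic (a ℕ.∸ b) b)
-- Here a - b is not positive, so the sign is discarded by passing to divisibility of absolute
-- values.
... | inj₂ a≤b = ∣ᵤ⇒∣ (subst₂ _∣ᵤ_ (sym (trans (cong ∣_∣ (ℤ.m-n≡m⊖n a b)) (ℤ.∣⊖∣-≤ a≤b)))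
  (trans (ℤ.∣i-j∣≡∣j-i∣ (f (a ℕ.+ (b ℕ.∸ a))) (f a)) (cong (λ k → ∣ f a ℤ.- f k ∣) (ℕ.m+[n∸m]≡n a≤b)))
  (∣⇒∣ᵤ (periodic (b ℕ.∸ a) a)))

scaledSum-integralDifferenceRatios : ∀ a → IntegralDifferenceRatios (scaledSum a)
scaledSum-integralDifferenceRatios a = periodic⇒integralDifferenceRatios (scaledSum a) (scaledSum-periodic a)

+c-integralDifferenceRatios : ∀ f c → IntegralDifferenceRatios f → IntegralDifferenceRatios (λ x → f x ℤ.+ c)
+c-integralDifferenceRatios f c idr a b a≢b = subst ((+ a ℤ.- + b) ∣ℤ_)
  (solve 3 (λ s t c → s :- t := (s :+ c) :- (t :+ c)) refl (f a) (f b) c) (idr a b a≢b)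
  where open ℤ.+-*-Solver

-- Integers inside the rationals, and elementary bounds

fromℤ-+ : ∀ i j → fromℤ (i ℤ.+ j) ≡ fromℤ i + fromℤ j
fromℤ-+ i j = ℚ.toℚᵘ-injective (ℚᵘ.≃-trans
  (ℚᵘ.*≡* (cong (_* 1ℤ) (sym (cong₂ ℤ._+_ (ℤ.*-identityʳ i) (ℤ.*-identityʳ j)))))
  (ℚᵘ.≃-sym (ℚ.toℚᵘ-homo-+ (fromℤ i) (fromℤ j))))

fromℤ-* : ∀ i j → fromℤ (i * j) ≡ fromℤ i ℚ.* fromℤ j
fromℤ-* i j = ℚ.toℚᵘ-injective (ℚᵘ.≃-sym (ℚ.toℚᵘ-homo-* (fromℤ i) (fromℤ j)))

p≤∣p∣ : ∀ p → p ≤ ℚ.∣ p ∣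
p≤∣p∣ p with ℚ.≤-total 0ℚ p
... | inj₁ 0≤p = ℚ.≤-reflexive (sym (ℚ.0≤p⇒∣p∣≡p 0≤p))
... | inj₂ p≤0 = ℚ.≤-trans p≤0 (ℚ.0≤∣p∣ p)

-p≤∣p∣ : ∀ p → - p ≤ ℚ.∣ p ∣
-p≤∣p∣ p = subst (- p ≤_) (ℚ.∣-p∣≡∣p∣ p) (p≤∣p∣ (- p))

-- Turns a recurrence n p = r into an upper bound for p without dividing.
≤-scaled : ∀ {m n p r} → m ℕ.≤ n → 0ℚ ≤ p → fromℕ n ℚ.* p ≡ r → fromℕ m ℚ.* p ≤ r
≤-scaled m≤n 0≤p refl = *-monoʳ 0≤p (fromℕ-mono-≤ m≤n)

0<-scaled : ∀ n {p r} → 0ℚ < r → fromℕ n ℚ.* p ≡ r → 0ℚ < p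
0<-scaled n {p} 0<r refl = ℚ.*-cancelˡ-<-nonNeg (fromℕ n) (subst (_< fromℕ n ℚ.* p) (sym (ℚ.*-zeroʳ (fromℕ n))) 0<r)

-- Floors and ceilings of reals strictly between consecutive integers

StrictlyBetweenSuccessors : ℤ → ℝ → Set
StrictlyBetweenSuccessors n r = ℤ→ℝ n <ᴿ r × r <ᴿ ℤ→ℝ (n ℤ.+ 1ℤ)

-- At an index beyond both thresholds, the two gaps would put `seq r k` strictly below itself.
<ᴿ-asym : ∀ {r s} → r <ᴿ s → r ≤ᴿ s
<ᴿ-asym {r} {s} (ε , 0<ε , M , r<s) (δ , 0<δ , N , s<r) = ℚ.<-irrefl refl (begin-strict
  seq r k            ≡⟨ ℚ.+-identityʳ (seq r k) ⟨
  seq r k + 0ℚ       <⟨ ℚ.+-monoʳ-< (seq r k) 0<ε ⟩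
  seq r k + ε        ≤⟨ r<s k (ℕ.m≤m+n M N) ⟩
  seq s k            ≡⟨ ℚ.+-identityʳ (seq s k) ⟨
  seq s k + 0ℚ       <⟨ ℚ.+-monoʳ-< (seq s k) 0<δ ⟩
  seq s k + δ        ≤⟨ s<r k (ℕ.m≤n+m N M) ⟩
  seq r k            ∎)
  where
  open ℚ.≤-Reasoning
  k : ℕ
  k = M ℕ.+ N

between⇒floor : ∀ {n r} → StrictlyBetweenSuccessors n r → n IsFloorOf r
between⇒floor {n} {r} (n<r , r<n+1) = <ᴿ-asym {ℤ→ℝ n} {r} n<r , r<n+1

between⇒ceiling : ∀ {n r} → StrictlyBetweenSuccessors n r → (n ℤ.+ 1ℤ) IsCeilingOf r
between⇒ceiling {n} {r} (n<r , r<n+1) =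
  subst (λ k → ℤ→ℝ k <ᴿ r) (solve 1 (λ n → n := (n :+ con 1ℤ) :- con 1ℤ) refl n) n<r ,
  <ᴿ-asym {r} {ℤ→ℝ (n ℤ.+ 1ℤ)} r<n+1
  where open ℤ.+-*-Solver

-- Scaled partial sums of the exponential series

scaledExp : (a : ℤ) .{{_ : NonZero a}} → ℕ → ℝ
scaledExp a x = fromℤ (a ^ x * + (x !)) · exp (1/ fromℤ a)

module _ (a : ℤ) .{{_ : NonZero a}} where

  private
    q : ℚ
    q = 1/ fromℤ a

    factor : ℕ → ℚ
    factor k = fromℤ (a ^ k * + (k !))

  -- Multiplying `expTerm-suc` by a cancels q = 1/a, so the coefficient is an integer.
  expTerm-recurrence : ∀ k → fromℤ (a * + suc k) ℚ.* expTerm q (suc k) ≡ expTerm q k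
  expTerm-recurrence k = begin
    fromℤ (a * + suc k) ℚ.* expTerm q (suc k)            ≡⟨ cong (ℚ._* expTerm q (suc k)) (fromℤ-* a (+ suc k)) ⟩
    fromℤ a ℚ.* fromℕ (suc k) ℚ.* expTerm q (suc k)      ≡⟨ ℚ.*-assoc (fromℤ a) (fromℕ (suc k)) (expTerm q (suc k)) ⟩
    fromℤ a ℚ.* (fromℕ (suc k) ℚ.* expTerm q (suc k))    ≡⟨ cong (fromℤ a ℚ.*_) (expTerm-suc q k) ⟩
    fromℤ a ℚ.* (q ℚ.* expTerm q k)                      ≡⟨ ℚ.*-assoc (fromℤ a) q (expTerm q k) ⟨
    fromℤ a ℚ.* q ℚ.* expTerm q k                        ≡⟨ cong (ℚ._* expTerm q k) (ℚ.*-inverseʳ (fromℤ a)) ⟩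
    1ℚ ℚ.* expTerm q k                                   ≡⟨ ℚ.*-identityˡ _ ⟩
    expTerm q k                                          ∎
    where open ≡-Reasoning

  factor-suc : ∀ k → factor (suc k) ≡ fromℤ (a * + suc k) ℚ.* factor k
  factor-suc k = trans (cong fromℤ (trans (cong (a ^ suc k *_) (ℤ.pos-* (suc k) (k !)))
      (solve 4 (λ a y m f → (a :* y) :* (m :* f) := (a :* m) :* (y :* f)) refl a (a ^ k) (+ suc k) (+ (k !)))))
    (fromℤ-* (a * + suc k) (a ^ k * + (k !)))
    where open ℤ.+-*-Solver

  -- The coefficient a (k + 1) gained by `factor` is the one lost by `expTerm`. This product is the
  -- summand 1 in the recurrence of `scaledSum`.
  factor*expTerm : ∀ k → factor k ℚ.* expTerm q k ≡ 1ℚ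
  factor*expTerm zero    = refl
  factor*expTerm (suc k) = begin
    factor (suc k) ℚ.* expTerm q (suc k)                         ≡⟨ cong (ℚ._* expTerm q (suc k)) (factor-suc k) ⟩
    fromℤ (a * + suc k) ℚ.* factor k ℚ.* expTerm q (suc k)       ≡⟨ solve 3 (λ u v w → u :* v :* w := v :* (u :* w)) refl (fromℤ (a * + suc k)) (factor k) (expTerm q (suc k)) ⟩
    factor k ℚ.* (fromℤ (a * + suc k) ℚ.* expTerm q (suc k))     ≡⟨ cong (factor k ℚ.*_) (expTerm-recurrence k) ⟩
    factor k ℚ.* expTerm q k                                     ≡⟨ factor*expTerm k ⟩
    1ℚ                                                           ∎
    where
    open ≡-Reasoning
    open ℚ.+-*-Solver

  -- Identifies `scaledSum` with the sum P x of the overview; the index `suc x` makes `expSum`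
  -- include the term k = x.
  factor*expSum : ∀ x → factor x ℚ.* expSum q (suc x) ≡ fromℤ (scaledSum a x)
  factor*expSum zero    = refl
  factor*expSum (suc x) = begin
    factor (suc x) ℚ.* (expSum q (suc x) + expTerm q (suc x))                          ≡⟨ ℚ.*-distribˡ-+ (factor (suc x)) (expSum q (suc x)) (expTerm q (suc x)) ⟩
    factor (suc x) ℚ.* expSum q (suc x) + factor (suc x) ℚ.* expTerm q (suc x)         ≡⟨ cong₂ _+_ (cong (ℚ._* expSum q (suc x)) (factor-suc x)) (factor*expTerm (suc x)) ⟩
    c ℚ.* factor x ℚ.* expSum q (suc x) + 1ℚ                                           ≡⟨ cong (_+ 1ℚ) (ℚ.*-assoc c (factor x) (expSum q (suc x))) ⟩
    c ℚ.* (factor x ℚ.* expSum q (suc x)) + 1ℚ                                         ≡⟨ cong (λ p → c ℚ.* p + 1ℚ) (factor*expSum x) ⟩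
    c ℚ.* fromℤ (scaledSum a x) + 1ℚ                                                   ≡⟨ cong (_+ 1ℚ) (fromℤ-* (a * + suc x) (scaledSum a x)) ⟨
    fromℤ (a * + suc x * scaledSum a x) + 1ℚ                                           ≡⟨ fromℤ-+ (a * + suc x * scaledSum a x) 1ℤ ⟨
    fromℤ (scaledSum a (suc x))                                                        ∎
    where
    open ≡-Reasoning
    c : ℚ
    c = fromℤ (a * + suc x)

  -- The terms beyond P x

  module Remainder (x : ℕ) where

    -- For fixed x this is definitionally the Cauchy sequence of `scaledExp a x`; `τ` gives its
    -- increments.
    u : ℕ → ℚ
    u n = factor x ℚ.* expSum q n

    τ : ℕ → ℚ
    τ k = factor x ℚ.* expTerm q k

    u-suc : ∀ k → u (suc k) ≡ u k + τ k
    u-suc k = ℚ.*-distribˡ-+ (factor x) (expSum q k) (expTerm q k)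

    τ-recurrence : ∀ k → fromℤ (a * + suc k) ℚ.* τ (suc k) ≡ τ k
    τ-recurrence k = trans
      (solve 3 (λ c f e → c :* (f :* e) := f :* (c :* e)) refl (fromℤ (a * + suc k)) (factor x) (expTerm q (suc k)))
      (cong (factor x ℚ.*_) (expTerm-recurrence k))
      where open ℚ.+-*-Solver

    ∣τ∣-recurrence : ∀ k → fromℕ (∣ a ∣ ℕ.* suc k) ℚ.* ℚ.∣ τ (suc k) ∣ ≡ ℚ.∣ τ k ∣
    ∣τ∣-recurrence k = begin
      fromℕ (∣ a ∣ ℕ.* suc k) ℚ.* ℚ.∣ τ (suc k) ∣    ≡⟨ cong (λ n → fromℕ n ℚ.* ℚ.∣ τ (suc k) ∣) (ℤ.abs-* a (+ suc k)) ⟨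
      ℚ.∣ fromℤ (a * + suc k) ∣ ℚ.* ℚ.∣ τ (suc k) ∣  ≡⟨ ℚ.∣p*q∣≡∣p∣*∣q∣ (fromℤ (a * + suc k)) (τ (suc k)) ⟨
      ℚ.∣ fromℤ (a * + suc k) ℚ.* τ (suc k) ∣        ≡⟨ cong ℚ.∣_∣ (τ-recurrence k) ⟩
      ℚ.∣ τ k ∣                                      ∎
      where open ≡-Reasoning

    -- The ratio ∣a∣ (k + 1) is at least 3, as a ≠ 0 and k ≥ 2. The induction in `tail` spends three
    -- copies of each new term: two on the doubled distance, one to carry along.
    3∣τ∣≤ : ∀ k → 2 ℕ.≤ k → fromℕ 3 ℚ.* ℚ.∣ τ (suc k) ∣ ≤ ℚ.∣ τ k ∣
    3∣τ∣≤ k 2≤k = ≤-scaled (ℕ.≤-trans (s≤s 2≤k) (ℕ.m≤n*m (suc k) ∣ a ∣)) (ℚ.0≤∣p∣ (τ (suc k))) (∣τ∣-recurrence k)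

    -- The terms shrink at least threefold, so the terms after the k-th add up to at most half of it.
    tail : ∀ k → 2 ℕ.≤ k → ∀ j →
      fromℕ 2 ℚ.* ℚ.∣ u (suc (j ℕ.+ k)) - u (suc k) ∣ + ℚ.∣ τ (j ℕ.+ k) ∣ ≤ ℚ.∣ τ k ∣
    tail k 2≤k zero    = ℚ.≤-reflexive (trans
      (cong (λ p → fromℕ 2 ℚ.* ℚ.∣ p ∣ + ℚ.∣ τ k ∣) (ℚ.+-inverseʳ (u (suc k)))) (ℚ.+-identityˡ ℚ.∣ τ k ∣))
    tail k 2≤k (suc j) = begin
      fromℕ 2 ℚ.* ℚ.∣ u (suc (suc i)) - v ∣ + t              ≡⟨ cong (λ p → fromℕ 2 ℚ.* ℚ.∣ p - v ∣ + t) (u-suc (suc i)) ⟩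
      fromℕ 2 ℚ.* ℚ.∣ (u (suc i) + τ (suc i)) - v ∣ + t      ≡⟨ cong (λ p → fromℕ 2 ℚ.* ℚ.∣ p ∣ + t) (solve 3 (λ u w v → (u :+ w) :- v := (u :- v) :+ w) refl (u (suc i)) (τ (suc i)) v) ⟩
      fromℕ 2 ℚ.* ℚ.∣ (u (suc i) - v) + τ (suc i) ∣ + t      ≤⟨ ℚ.+-monoˡ-≤ t (*-monoˡ (0≤fromℕ 2) (ℚ.∣p+q∣≤∣p∣+∣q∣ (u (suc i) - v) (τ (suc i)))) ⟩
      fromℕ 2 ℚ.* (D + t) + t                                ≡⟨ solve 2 (λ d t → con (fromℕ 2) :* (d :+ t) :+ t := con (fromℕ 2) :* d :+ con (fromℕ 3) :* t) refl D t ⟩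
      fromℕ 2 ℚ.* D + fromℕ 3 ℚ.* t                          ≤⟨ ℚ.+-monoʳ-≤ (fromℕ 2 ℚ.* D) (3∣τ∣≤ i (ℕ.≤-trans 2≤k (ℕ.m≤n+m k j))) ⟩
      fromℕ 2 ℚ.* D + ℚ.∣ τ i ∣                              ≤⟨ tail k 2≤k j ⟩
      ℚ.∣ τ k ∣                                              ∎
      where
      open ℚ.≤-Reasoning
      open ℚ.+-*-Solver
      i : ℕ
      i = j ℕ.+ k
      v t D : ℚ
      v = u (suc k)
      t = ℚ.∣ τ (suc i) ∣
      D = ℚ.∣ u (suc i) - v ∣

    T T′ h base : ℚ
    T = τ (suc x)
    T′ = τ (suc (suc x))
    h = ½ ℚ.* T′
    base = fromℤ (scaledSum a x)

    u-base : u (suc (suc (suc x))) ≡ base + T + T′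
    u-base = trans (u-suc (suc (suc x))) (cong (_+ T′) (trans (u-suc (suc x)) (cong (_+ T) (factor*expSum x))))

    -- Applies `tail` from k = x + 2, which is at least 2 even for x = 0. From k = x + 1 this would
    -- fail, hence two terms are split off.
    tail-half : 0ℚ < T′ → ∀ m → suc (suc (suc x)) ℕ.≤ m → ℚ.∣ u m - (base + T + T′) ∣ ≤ h
    tail-half 0<T′ m k<m = begin
      ℚ.∣ u m - (base + T + T′) ∣           ≡⟨ cong₂ (λ m v → ℚ.∣ u m - v ∣) (trans (sym (ℕ.+-suc j k)) (ℕ.m∸n+n≡m k<m)) u-base ⟨
      D                                     ≡⟨ solve 1 (λ d → d := con ½ :* (con (fromℕ 2) :* d)) refl D ⟩
      ½ ℚ.* (fromℕ 2 ℚ.* D)                 ≤⟨ *-monoˡ (ℚ.nonNegative⁻¹ ½) 2D≤T′ ⟩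
      h                                     ∎
      where
      open ℚ.≤-Reasoning
      open ℚ.+-*-Solver
      k j : ℕ
      k = suc (suc x)
      j = m ℕ.∸ suc k
      D : ℚ
      D = ℚ.∣ u (suc (j ℕ.+ k)) - u (suc k) ∣
      2D≤T′ : fromℕ 2 ℚ.* D ≤ T′
      2D≤T′ = begin
        fromℕ 2 ℚ.* D                          ≡⟨ ℚ.+-identityʳ (fromℕ 2 ℚ.* D) ⟨
        fromℕ 2 ℚ.* D + 0ℚ                     ≤⟨ ℚ.+-monoʳ-≤ (fromℕ 2 ℚ.* D) (ℚ.0≤∣p∣ (τ (j ℕ.+ k))) ⟩
        fromℕ 2 ℚ.* D + ℚ.∣ τ (j ℕ.+ k) ∣      ≤⟨ tail k (s≤s (s≤s z≤n)) j ⟩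
        ℚ.∣ T′ ∣                               ≡⟨ ℚ.0≤p⇒∣p∣≡p (ℚ.<⇒≤ 0<T′) ⟩
        T′                                     ∎

    -- Late values of `u` lie between `base + T + h` and `base + T + 3h`. Spending another `h` on
    -- each side as the gap that `<ᴿ` demands leaves `base + T` and `base + T + 2T′`, which the
    -- hypotheses compare with c and c + 1.
    between : ∀ c → 0ℚ < T′ → fromℤ c ≤ T → T + fromℕ 2 ℚ.* T′ ≤ fromℤ (c ℤ.+ 1ℤ) →
      StrictlyBetweenSuccessors (scaledSum a x ℤ.+ c) (scaledExp a x)
    between c 0<T′ c≤T T+2T′≤c+1 = (h , 0<h , suc (suc (suc x)) , lower) , (h , 0<h , suc (suc (suc x)) , upper)
      where
      open ℚ.≤-Reasoning
      open ℚ.+-*-Solver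
      0<h : 0ℚ < h
      0<h = 0<* (ℚ.positive⁻¹ ½) 0<T′
      lower : ∀ m → suc (suc (suc x)) ℕ.≤ m → fromℤ (scaledSum a x ℤ.+ c) + h ≤ u m
      lower m k<m = begin
        fromℤ (scaledSum a x ℤ.+ c) + h        ≡⟨ cong (_+ h) (fromℤ-+ (scaledSum a x) c) ⟩
        base + fromℤ c + h                     ≤⟨ ℚ.+-monoˡ-≤ h (ℚ.+-monoʳ-≤ base c≤T) ⟩
        base + T + h                           ≡⟨ solve 3 (λ b t t′ → b :+ t :+ con ½ :* t′ := b :+ t :+ t′ :- con ½ :* t′) refl base T T′ ⟩
        base + T + T′ - h                      ≤⟨ ℚ.+-monoʳ-≤ (base + T + T′) (ℚ.neg-antimono-≤ (tail-half 0<T′ m k<m)) ⟩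
        base + T + T′ - ℚ.∣ D ∣                ≤⟨ ℚ.+-monoʳ-≤ (base + T + T′) (ℚ.neg-antimono-≤ (-p≤∣p∣ D)) ⟩
        base + T + T′ - (- D)                  ≡⟨ solve 2 (λ w u → w :- (:- (u :- w)) := u) refl (base + T + T′) (u m) ⟩
        u m                                    ∎
        where
        D : ℚ
        D = u m - (base + T + T′)
      upper : ∀ m → suc (suc (suc x)) ℕ.≤ m → u m + h ≤ fromℤ (scaledSum a x ℤ.+ c ℤ.+ 1ℤ)
      upper m k<m = begin
        u m + h                                ≡⟨ solve 3 (λ w u h → u :+ h := w :+ h :+ (u :- w)) refl (base + T + T′) (u m) h ⟩
        base + T + T′ + h + D                  ≤⟨ ℚ.+-monoʳ-≤ (base + T + T′ + h) (ℚ.≤-trans (p≤∣p∣ D) (tail-half 0<T′ m k<m)) ⟩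
        base + T + T′ + h + h                  ≡⟨ solve 3 (λ b t t′ → b :+ t :+ t′ :+ con ½ :* t′ :+ con ½ :* t′ := b :+ (t :+ con (fromℕ 2) :* t′)) refl base T T′ ⟩
        base + (T + fromℕ 2 ℚ.* T′)            ≤⟨ ℚ.+-monoʳ-≤ base T+2T′≤c+1 ⟩
        base + fromℤ (c ℤ.+ 1ℤ)                ≡⟨ fromℤ-+ (scaledSum a x) (c ℤ.+ 1ℤ) ⟨
        fromℤ (scaledSum a x ℤ.+ (c ℤ.+ 1ℤ))   ≡⟨ cong fromℤ (ℤ.+-assoc (scaledSum a x) c 1ℤ) ⟨
        fromℤ (scaledSum a x ℤ.+ c ℤ.+ 1ℤ)     ∎
        where
        D : ℚ
        D = u m - (base + T + T′)

-- Size of the remainder by the sign of a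

-- Here 2T′ ≤ T and 2T ≤ 1, so T + 2T′ ≤ 1. The bound 2T ≤ 1 is where a = 1, x = 0 drops out, since
-- there T = 1.
remainder-pos : ∀ n x → 2 ℕ.≤ suc n ℕ.* suc x →
  StrictlyBetweenSuccessors (scaledSum (+ suc n) x ℤ.+ 0ℤ) (scaledExp (+ suc n) x)
remainder-pos n x 2≤ = between 0ℤ 0<T′ (ℚ.<⇒≤ 0<T) (begin
  T + fromℕ 2 ℚ.* T′    ≤⟨ ℚ.+-monoʳ-≤ T (≤-scaled 2≤′ (ℚ.<⇒≤ 0<T′) T′-eq) ⟩
  T + T                 ≡⟨ solve 1 (λ t → t :+ t := con (fromℕ 2) :* t) refl T ⟩
  fromℕ 2 ℚ.* T         ≤⟨ ≤-scaled 2≤ (ℚ.<⇒≤ 0<T) T-eq ⟩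
  1ℚ                    ∎)
  where
  open ℚ.≤-Reasoning
  open ℚ.+-*-Solver
  open Remainder (+ suc n) x
  2≤′ : 2 ℕ.≤ suc n ℕ.* suc (suc x)
  2≤′ = ℕ.≤-trans (s≤s (s≤s z≤n)) (ℕ.m≤n*m (suc (suc x)) (suc n))
  T-eq : fromℕ (suc n ℕ.* suc x) ℚ.* T ≡ 1ℚ
  T-eq = trans (τ-recurrence x) (factor*expTerm (+ suc n) x)
  T′-eq : fromℕ (suc n ℕ.* suc (suc x)) ℚ.* T′ ≡ T
  T′-eq = τ-recurrence (suc x)
  0<T : 0ℚ < T
  0<T = 0<-scaled (suc n ℕ.* suc x) 0<1ℚ T-eq
  0<T′ : 0ℚ < T′
  0<T′ = 0<-scaled (suc n ℕ.* suc (suc x)) 0<T T′-eq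

-- Now -1 ≤ T < 0 and 2T′ ≤ -T. The case a = -1, x = 0 is included although T = -1 there: strictness
-- comes from T′ > 0.
remainder-neg : ∀ n x →
  StrictlyBetweenSuccessors (scaledSum -[1+ n ] x ℤ.+ -1ℤ) (scaledExp -[1+ n ] x)
remainder-neg n x = between -1ℤ 0<T′
  (begin
    - 1ℚ                    ≤⟨ ℚ.neg-antimono-≤ (≤-scaled (s≤s z≤n) (ℚ.<⇒≤ 0<-T) T-eq) ⟩
    - (1ℚ ℚ.* - T)          ≡⟨ solve 1 (λ t → :- (con 1ℚ :* :- t) := t) refl T ⟩
    T                       ∎)
  (begin
    T + fromℕ 2 ℚ.* T′      ≤⟨ ℚ.+-monoʳ-≤ T (≤-scaled 2≤ (ℚ.<⇒≤ 0<T′) T′-eq) ⟩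
    T - T                   ≡⟨ ℚ.+-inverseʳ T ⟩
    0ℚ                      ∎)
  where
  open ℚ.≤-Reasoning
  open ℚ.+-*-Solver
  open Remainder -[1+ n ] x
  2≤ : 2 ℕ.≤ suc n ℕ.* suc (suc x)
  2≤ = ℕ.≤-trans (s≤s (s≤s z≤n)) (ℕ.m≤n*m (suc (suc x)) (suc n))
  T-eq : fromℕ (suc n ℕ.* suc x) ℚ.* - T ≡ 1ℚ
  -- The sign of a moves from the coefficient to T, because `≤-scaled` and `0<-scaled` take natural
  -- coefficients.
  T-eq = trans (solve 2 (λ c t → c :* :- t := :- c :* t) refl (fromℕ (suc n ℕ.* suc x)) T)
    (trans (τ-recurrence x) (factor*expTerm -[1+ n ] x))
  T′-eq : fromℕ (suc n ℕ.* suc (suc x)) ℚ.* T′ ≡ - T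
  T′-eq = trans (solve 2 (λ c t → c :* t := :- (:- c :* t)) refl (fromℕ (suc n ℕ.* suc (suc x))) T′)
    (cong -_ (τ-recurrence (suc x)))
  0<-T : 0ℚ < - T
  0<-T = 0<-scaled (suc n ℕ.* suc x) 0<1ℚ T-eq
  0<T′ : 0ℚ < T′
  0<T′ = 0<-scaled (suc n ℕ.* suc (suc x)) 0<-T T′-eq

remainder-one : ∀ x → x ≥ 1 → StrictlyBetweenSuccessors (scaledSum 1ℤ x ℤ.+ 0ℤ) (fromℤ (+ (x !)) · e)
-- The power `1ℤ ^ x` does not reduce for variable x, so the factor 1 is removed by transport.
remainder-one x x≥1 = subst (λ k → StrictlyBetweenSuccessors (scaledSum 1ℤ x ℤ.+ 0ℤ) (fromℤ k · e))
  (trans (cong (_* + (x !)) (ℤ.^-zeroˡ x)) (ℤ.*-identityˡ (+ (x !))))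
  (remainder-pos 0 x (ℕ.≤-trans (s≤s x≥1) (ℕ.m≤n*m (suc x) 1)))

-- Floor and ceiling functions as P plus a constant

floor-and-ceiling : ∀ a .{{_ : NonZero a}} c → (∀ x → StrictlyBetweenSuccessors (scaledSum a x ℤ.+ c) (scaledExp a x)) →
  (∃[ φ⁻ ] (∀ x → φ⁻ x IsFloorOf scaledExp a x) × IntegralDifferenceRatios φ⁻) ×
  (∃[ φ⁺ ] (∀ x → φ⁺ x IsCeilingOf scaledExp a x) × IntegralDifferenceRatios φ⁺)
floor-and-ceiling a c between =
  (_ , (λ x → between⇒floor {_} {scaledExp a x} (between x)) , φ⁻-idr) ,
  (_ , (λ x → between⇒ceiling {_} {scaledExp a x} (between x)) ,
    +c-integralDifferenceRatios (λ x → scaledSum a x ℤ.+ c) 1ℤ φ⁻-idr)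
  where
  φ⁻-idr : IntegralDifferenceRatios (λ x → scaledSum a x ℤ.+ c)
  φ⁻-idr = +c-integralDifferenceRatios (scaledSum a) c (scaledSum-integralDifferenceRatios a)

theorem3p1 : ((a : ℤ) .{{_ : NonZero a}} → a ≢ + 1 →
    (∃[ φ⁻ ] (∀ (x : ℕ) → φ⁻ x IsFloorOf (fromℤ (a ^ x * + (x !)) · exp (1/ fromℤ a)))
    × IntegralDifferenceRatios φ⁻)
    ×
    (∃[ φ⁺ ] (∀ (x : ℕ) → φ⁺ x IsCeilingOf (fromℤ (a ^ x * + (x !)) · exp (1/ fromℤ a)))
    × IntegralDifferenceRatios φ⁺))
    ×
    (∃[ φ₁⁻ ] φ₁⁻ 0 ≡ + 1
    × (∀ (x : ℕ) → x ≥ 1 → φ₁⁻ x IsFloorOf (fromℤ (+ (x !)) · e))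
    × IntegralDifferenceRatios φ₁⁻)
    ×
    (∃[ φ₁⁺ ] φ₁⁺ 0 ≡ + 2
    × (∀ (x : ℕ) → x ≥ 1 → φ₁⁺ x IsCeilingOf (fromℤ (+ (x !)) · e))
    × IntegralDifferenceRatios φ₁⁺)
theorem3p1 =
  (λ { (+ 0)           {{()}} a≢1
     ; (+ 1)           a≢1 → contradiction refl a≢1
     ; (+ suc (suc n)) _   → floor-and-ceiling (+ suc (suc n)) 0ℤ λ x →
         remainder-pos (suc n) x (ℕ.≤-trans (s≤s (s≤s z≤n)) (ℕ.m≤m*n (suc (suc n)) (suc x)))
     ; -[1+ n ]        _   → floor-and-ceiling -[1+ n ] -1ℤ (remainder-neg n) }) ,
  -- The prescribed values 1 and 2 at x = 0 are P 0 and P 0 + 1, so one formula covers every x.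
  (φ₁⁻ , refl , (λ x x≥1 → between⇒floor {_} {fromℤ (+ (x !)) · e} (remainder-one x x≥1)) , φ₁⁻-idr) ,
  (_ , refl , (λ x x≥1 → between⇒ceiling {_} {fromℤ (+ (x !)) · e} (remainder-one x x≥1)) ,
    +c-integralDifferenceRatios φ₁⁻ 1ℤ φ₁⁻-idr)
  where
  φ₁⁻ : ℕ → ℤ
  φ₁⁻ x = scaledSum 1ℤ x ℤ.+ 0ℤ
  φ₁⁻-idr : IntegralDifferenceRatios φ₁⁻
  φ₁⁻-idr = +c-integralDifferenceRatios (scaledSum 1ℤ) 0ℤ (scaledSum-integralDifferenceRatios 1ℤ)
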